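{- Let $p$ be a prime number, $n$ a positive integer and $Q\in\mathbb{Z}[X_1,\dots,X_n]$ a quadratic form. Then the set $R(\mathbb{N}\cap Q(\mathbb{Z}^n))$ is dense in $\mathbb{Q}_p$ if and only if $R(Q(\mathbb{Z}^n))$ is dense in $\mathbb{Q}_p$ and $\mathbb{N}_+\cap Q(\mathbb{Z}^n)\neq\varnothing$. Likewise, $R(\mathbb{N}\cap Q(\mathbb{N}^n))$ is dense in $\mathbb{Q}_p$ if and only if $R(Q(\mathbb{N}^n))$ is dense in $\mathbb{Q}_p$ and $\mathbb{N}_+\cap Q(\mathbb{N}^n)\neq\varnothing$.
   Context: $\mathbb{N}$ denotes the nonnegative integers and $\mathbb{N}_+$ the positive integers. A quadratic form is a homogeneous polynomial of degree two, not all coefficients zero. For a subset $A$ of a field, $R(A)=\{a/b: a,b\in A,\ b\neq 0\}$. For $S\subseteq\mathbb{Z}^n$, $Q(S)=\{Q(\mathbf{x}):\mathbf{x}\in S\}$. Density is with respect to the $p$-adic topology on $\mathbb{Q}_p$. -}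

module Defs where

open import Level using (0ℓ)
open import Data.Nat.Base as ℕ using (ℕ; zero; suc)
open import Data.Nat.Divisibility using (_∣?_)
open import Data.Integer.Base as ℤ using (ℤ; 0ℤ; +_)
open import Data.Integer.Properties using (+-*-commutativeRing)
open import Data.Rational.Base as ℚ using (ℚ; 0ℚ; ↥_; ↧ₙ_; _÷_)
open import Data.Rational.Properties using (+-inverseʳ)
open import Data.Fin.Base as Fin using (Fin)
open import Data.Vec.Functional using (Vector)
open import Data.Product.Base using (Σ; ∃; _×_; _,_)
open import Relation.Unary using (Pred; _∈_)
open import Relation.Nullary using (¬_; yes; no; contradiction)
open import Relation.Binary.PropositionalEquality using (_≡_; _≢_)
open import Algebra.Bundles using (CommutativeRing)
open import Algebra.Properties.Semiring.Sum
  (CommutativeRing.semiring +-*-commutativeRing) using (sum)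

-- The form Σ_{i ≤ j} coeff i j · Xᵢ Xⱼ: the monomial Xᵢ Xⱼ with i ≤ j has its
-- coefficient at position (i , j), and the entries below the diagonal are zero,
-- so the array is uniquely determined by the polynomial.  In particular the
-- coefficients of the mixed monomials need not be even.
record QuadraticForm (n : ℕ) : Set where
  field
    coeff    : Fin n → Fin n → ℤ
    upper    : ∀ i j → j Fin.< i → coeff i j ≡ 0ℤ
    non-zero : ¬ (∀ i j → coeff i j ≡ 0ℤ)

  eval : Vector ℤ n → ℤ
  eval x = sum λ i → sum λ j → coeff i j ℤ.* (x i ℤ.* x j)

open QuadraticForm public using (eval)

ℕ^ : ∀ n → Pred (Vector ℤ n) 0ℓ
ℕ^ n x = ∀ i → ℤ.NonNegative (x i)

infix 8 _[_]

_[_] : ∀ {n} → QuadraticForm n → Pred (Vector ℤ n) 0ℓ → Pred ℤ 0ℓ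
(Q [ S ]) z = ∃ λ x → x ∈ S × z ≡ eval Q x

asRationals : Pred ℤ 0ℓ → Pred ℚ 0ℓ
asRationals A q = ∃ λ z → z ∈ A × q ≡ z ℚ./ 1

Ratios : Pred ℚ 0ℓ → Pred ℚ 0ℓ
Ratios A q = ∃ λ a → ∃ λ b → a ∈ A × b ∈ A ×
  Σ (ℚ.NonZero b) λ b≢0 → q ≡ (a ÷ b) {{b≢0}}

R : Pred ℤ 0ℓ → Pred ℚ 0ℓ
R A = Ratios (asRationals A)

-- The greatest e ≤ bound such that p ^ e divides m.
maxExponent : (p m bound : ℕ) → ℕ
maxExponent p m zero = 0
maxExponent p m (suc e) with p ℕ.^ suc e ∣? m
... | yes _ = suc e
... | no  _ = maxExponent p m e

-- For p ≥ 2 and m ≥ 1, p ^ e ∣ m forces e < p ^ e ≤ m, so the bound m loses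
-- nothing.  The value at m = 0 is junk and never matters below.
νℕ : (p m : ℕ) → ℕ
νℕ p m = maxExponent p m m

-- Meaningful for q ≢ 0ℚ only.
ν : ℕ → ℚ → ℤ
ν p q = + νℕ p (ℤ.∣ ↥ q ∣) ℤ.- + νℕ p (↧ₙ q)

-- Norm≤ p k q says |q|ₚ ≤ p ^ (- k), where |0|ₚ = 0 and |q|ₚ = p ^ (- ν p q)
-- for q ≢ 0ℚ.
Norm≤ : ℕ → ℤ → ℚ → Set
Norm≤ p k q = q ≢ 0ℚ → k ℤ.≤ ν p q

-- ℚₚ is the completion of ℚ at |·|ₚ: Cauchy sequences, taken modulo _≈_.
record ℚₚ (p : ℕ) : Set where
  field
    seq    : ℕ → ℚ
    cauchy : ∀ k → ∃ λ N → ∀ m n → N ℕ.≤ m → N ℕ.≤ n →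
             Norm≤ p k (seq m ℚ.- seq n)

open ℚₚ public using (seq)

-- Dist≤ k x y says |x - y|ₚ ≤ p ^ (- k).  Requiring the bound on all late terms
-- is equivalent to requiring it of the limit of |seq x m - seq y m|ₚ: since the
-- values of |·|ₚ are discrete away from 0, these norms are eventually constant
-- or tend to 0.
Dist≤ : ∀ {p} → ℤ → ℚₚ p → ℚₚ p → Set
Dist≤ {p} k x y = ∃ λ N → ∀ m → N ℕ.≤ m → Norm≤ p k (seq x m ℚ.- seq y m)

infix 4 _≈_

_≈_ : ∀ {p} → ℚₚ p → ℚₚ p → Set
x ≈ y = ∀ k → Dist≤ k x y

ι : ∀ p → ℚ → ℚₚ p
ι p q = record
  { seq    = λ _ → q
  ; cauchy = λ _ → 0 , λ _ _ _ _ q-q≢0 → contradiction (+-inverseʳ q) q-q≢0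
  }

-- The balls { y | |x - y|ₚ ≤ p ^ (- k) } form a basis of the topology of ℚₚ.
-- A set of rationals is dense when its image under ι meets each of them.
DenseInℚₚ : ℕ → Pred ℚ 0ℓ → Set
DenseInℚₚ p A = ∀ (x : ℚₚ p) (k : ℤ) → ∃ λ q → q ∈ A × Dist≤ k x (ι p q)

{-# OPTIONS --safe #-}
module Submission where

-- If Q(y) > 0, then Q(x + s y) = Q(x) + s B(x , y) + s² Q(y), with B the polar
-- form, is positive for every large s ∈ ℕ; taking s divisible by a high power
-- of p moves Q(x) only slightly in the p-adic topology.  Given a ratio a / b of
-- values with b ≠ 0, take s divisible by p ^ k · b².  The perturbed values are
-- a′ = a + p ^ k b² u and b′ = b + p ^ k b² v, so that
--   a / b - a′ / b′ = p ^ k (a v - b u) / (1 + p ^ k b v),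
-- whose denominator is prime to p when k ≥ 1: no valuation of b is needed.

open import Defs
open import Level using (0ℓ)
open import Data.Nat.Base as ℕ using (ℕ; zero; suc; NonZero; NonTrivial; nonTrivial⇒n>1)
import Data.Nat.Properties as ℕ
open import Data.Nat.Divisibility as ℕ using (_∣_; _∤_; _∣?_; divides)
open import Data.Nat.Primality using (Prime; prime⇒nonZero; prime⇒nonTrivial; euclidsLemma)
open import Data.Integer.Base as ℤ using (ℤ; +_; -[1+_]; +[1+_]; 0ℤ; 1ℤ; ∣_∣; NonNegative; Positive)
import Data.Integer.Properties as ℤ
import Data.Integer.Divisibility.Signed as ℤ∣
open import Data.Integer.Tactic.RingSolver using (solve-∀)
open import Data.Rational.Base as ℚ using (ℚ; mkℚ; 0ℚ; ↥_; ↧_; ↧ₙ_; toℚᵘ; 1/_; _÷_)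
import Data.Rational.Properties as ℚ
import Data.Nat.Coprimality as C
import Data.Rational.Solver as ℚ
import Data.Rational.Unnormalised.Base as ℚᵘ
import Data.Rational.Unnormalised.Properties as ℚᵘ
open import Data.Fin.Base using (Fin)
open import Data.Product.Base using (∃; _×_; _,_; proj₁; proj₂)
open import Data.Sum.Base using (inj₁; inj₂)
open import Data.Vec.Functional using (Vector)
open import Function.Bundles using (_⇔_; mk⇔)
open import Relation.Binary.PropositionalEquality
  using (_≡_; _≢_; refl; sym; trans; cong; cong₂; subst; module ≡-Reasoning)
open import Relation.Nullary using (yes; no; contradiction)
open import Relation.Unary using (Pred; _∈_; _⊆_; U; _∩_; Satisfiable)
open import Algebra.Bundles using (CommutativeRing)
open import Algebra.Properties.Semiring.Sum (CommutativeRing.semiring ℤ.+-*-commutativeRing)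
  using (sum; sum-cong-≗; ∑-distrib-+; *-distribˡ-sum)

-- Powers of a prime dividing a natural number.

n<m^n : ∀ m .{{_ : NonTrivial m}} n → n ℕ.< m ℕ.^ n
n<m^n m zero    = ℕ.z<s
n<m^n m (suc n) = ℕ.≤-<-trans (n<m^n m n) (ℕ.^-monoʳ-< m (nonTrivial⇒n>1 m) (ℕ.n<1+n n))

maxExponent-∣ : ∀ p m b → p ℕ.^ maxExponent p m b ∣ m
maxExponent-∣ p m zero = ℕ.1∣ m
maxExponent-∣ p m (suc b) with p ℕ.^ suc b ∣? m
... | yes pᵇ∣m = pᵇ∣m
... | no  _    = maxExponent-∣ p m b

maxExponent-max : ∀ p m b {e} → e ℕ.≤ b → p ℕ.^ e ∣ m → e ℕ.≤ maxExponent p m b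
maxExponent-max p m zero    e≤0 _ = e≤0
maxExponent-max p m (suc b) e≤1+b pᵉ∣m with p ℕ.^ suc b ∣? m
... | yes _    = e≤1+b
... | no  pᵇ∤m with ℕ.m≤n⇒m<n∨m≡n e≤1+b
...   | inj₁ e<1+b = maxExponent-max p m b (ℕ.≤-pred e<1+b) pᵉ∣m
...   | inj₂ refl  = contradiction pᵉ∣m pᵇ∤m

p∣p^suc : ∀ p e → p ∣ p ℕ.^ suc e
p∣p^suc p e = ℕ.m∣m*n (p ℕ.^ e)

p∤m⇒νℕ≡0 : ∀ {p m} → p ∤ m → νℕ p m ≡ 0
p∤m⇒νℕ≡0 {p} {m} p∤m with νℕ p m | maxExponent-∣ p m m
... | zero  | _    = refl
... | suc e | pᵉ∣m = contradiction (ℕ.∣-trans (p∣p^suc p e) pᵉ∣m) p∤m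

νℕ-max : ∀ p .{{_ : NonTrivial p}} m .{{_ : NonZero m}} {e} → p ℕ.^ e ∣ m → e ℕ.≤ νℕ p m
νℕ-max p m {e} pᵉ∣m =
  -- The search bound is no restriction, since `e < p ^ e ≤ m`.
  maxExponent-max p m m (ℕ.<⇒≤ (ℕ.<-≤-trans (n<m^n p e) (ℕ.∣⇒≤ pᵉ∣m))) pᵉ∣m

-- Integers inside the rationals, and identities with denominators cleared.

i/1≃i : ∀ i → toℚᵘ (i ℚ./ 1) ℚᵘ.≃ ℚᵘ.mkℚᵘ i 0
i/1≃i i = ℚ.toℚᵘ-fromℚᵘ (ℚᵘ.mkℚᵘ i 0)

/1-homo-+ : ∀ i j → (i ℤ.+ j) ℚ./ 1 ≡ (i ℚ./ 1) ℚ.+ (j ℚ./ 1)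
/1-homo-+ i j = ℚ.toℚᵘ-injective (begin
  toℚᵘ ((i ℤ.+ j) ℚ./ 1)                ≈⟨ i/1≃i (i ℤ.+ j) ⟩
  ℚᵘ.mkℚᵘ (i ℤ.+ j) 0                   ≈⟨ ℚᵘ.*≡* (lemma i j) ⟩
  ℚᵘ.mkℚᵘ i 0 ℚᵘ.+ ℚᵘ.mkℚᵘ j 0          ≈⟨ ℚᵘ.+-cong (i/1≃i i) (i/1≃i j) ⟨
  toℚᵘ (i ℚ./ 1) ℚᵘ.+ toℚᵘ (j ℚ./ 1)    ≈⟨ ℚ.toℚᵘ-homo-+ (i ℚ./ 1) (j ℚ./ 1) ⟨
  toℚᵘ ((i ℚ./ 1) ℚ.+ (j ℚ./ 1))            ∎)
  where
  open ℚᵘ.≃-Reasoning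
  lemma : ∀ i j → (i ℤ.+ j) ℤ.* 1ℤ ≡ (i ℤ.* 1ℤ ℤ.+ j ℤ.* 1ℤ) ℤ.* 1ℤ
  lemma = solve-∀

/1-homo-* : ∀ i j → (i ℤ.* j) ℚ./ 1 ≡ (i ℚ./ 1) ℚ.* (j ℚ./ 1)
/1-homo-* i j = ℚ.toℚᵘ-injective (begin
  toℚᵘ ((i ℤ.* j) ℚ./ 1)                ≈⟨ i/1≃i (i ℤ.* j) ⟩
  ℚᵘ.mkℚᵘ (i ℤ.* j) 0                   ≈⟨ ℚᵘ.*≡* refl ⟩
  ℚᵘ.mkℚᵘ i 0 ℚᵘ.* ℚᵘ.mkℚᵘ j 0          ≈⟨ ℚᵘ.*-cong (i/1≃i i) (i/1≃i j) ⟨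
  toℚᵘ (i ℚ./ 1) ℚᵘ.* toℚᵘ (j ℚ./ 1)    ≈⟨ ℚ.toℚᵘ-homo-* (i ℚ./ 1) (j ℚ./ 1) ⟨
  toℚᵘ ((i ℚ./ 1) ℚ.* (j ℚ./ 1))            ∎)
  where open ℚᵘ.≃-Reasoning

q*i≡j⇒↥q*i≡j*↧q : ∀ q i j → q ℚ.* (i ℚ./ 1) ≡ j ℚ./ 1 → ↥ q ℤ.* i ≡ j ℤ.* ↧ q
q*i≡j⇒↥q*i≡j*↧q q@record{} i j qi≡j = begin
  ↥ q ℤ.* i              ≡⟨ ℤ.*-identityʳ _ ⟨
  ↥ q ℤ.* i ℤ.* 1ℤ       ≡⟨ ℚᵘ.drop-*≡* qi≃j ⟩
  j ℤ.* + (↧ₙ q ℕ.* 1)   ≡⟨ cong (λ n → j ℤ.* + n) (ℕ.*-identityʳ (↧ₙ q)) ⟩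
  j ℤ.* ↧ q              ∎
  where
  open ≡-Reasoning
  qi≃j : toℚᵘ q ℚᵘ.* ℚᵘ.mkℚᵘ i 0 ℚᵘ.≃ ℚᵘ.mkℚᵘ j 0
  qi≃j = ℚᵘ.≃-trans (ℚᵘ.*-congˡ {toℚᵘ q} (ℚᵘ.≃-sym (i/1≃i i)))
    (ℚᵘ.≃-trans (ℚᵘ.≃-sym (ℚ.toℚᵘ-homo-* q (i ℚ./ 1)))
    (ℚᵘ.≃-trans (ℚ.toℚᵘ-cong qi≡j) (i/1≃i j)))

-- The sum is stored in lowest terms, so its numerator has no polynomial formula. Cross-multiplying
-- avoids naming the cancelled gcd.
↥-+-cross : ∀ q r → ↥ (q ℚ.+ r) ℤ.* (↧ q ℤ.* ↧ r) ≡
                    (↥ q ℤ.* ↧ r ℤ.+ ↥ r ℤ.* ↧ q) ℤ.* ↧ (q ℚ.+ r)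
↥-+-cross q@record{} r@record{} with q ℚ.+ r | ℚ.toℚᵘ-homo-+ q r
... | record{} | eq = ℚᵘ.drop-*≡* eq

≢0⇒↥-nonZero : ∀ {q} → q ≢ 0ℚ → NonZero ∣ ↥ q ∣
≢0⇒↥-nonZero {q} q≢0 = ℕ.≢-nonZero λ ∣↥q∣≡0 → q≢0 (ℚ.↥p≡0⇒p≡0 q (ℤ.∣i∣≡0⇒i≡0 ∣↥q∣≡0))

i≤+∣i∣ : ∀ i → i ℤ.≤ + ∣ i ∣
i≤+∣i∣ (+ n)    = ℤ.≤-refl
i≤+∣i∣ -[1+ n ] = ℤ.-≤+

-- Expansion of the form along a line.

sum² : ∀ {n} → (Fin n → Fin n → ℤ) → ℤ
sum² f = sum λ i → sum (f i)

sum²-cong : ∀ {n} {f g : Fin n → Fin n → ℤ} → (∀ i j → f i j ≡ g i j) → sum² f ≡ sum² g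
sum²-cong f≗g = sum-cong-≗ λ i → sum-cong-≗ (f≗g i)

sum²-distrib-+ : ∀ {n} (f g : Fin n → Fin n → ℤ) →
                 sum² (λ i j → f i j ℤ.+ g i j) ≡ sum² f ℤ.+ sum² g
sum²-distrib-+ f g = trans (sum-cong-≗ λ i → ∑-distrib-+ (f i) (g i))
  (∑-distrib-+ (λ i → sum (f i)) (λ i → sum (g i)))

*-distribˡ-sum² : ∀ {n} c (f : Fin n → Fin n → ℤ) → c ℤ.* sum² f ≡ sum² (λ i j → c ℤ.* f i j)
*-distribˡ-sum² c f = trans (*-distribˡ-sum c (λ i → sum (f i)))
  (sum-cong-≗ λ i → *-distribˡ-sum c (f i))

polar : ∀ {n} → QuadraticForm n → Vector ℤ n → Vector ℤ n → ℤ
polar Q x y = sum² λ i j → coeff i j ℤ.* (x i ℤ.* y j ℤ.+ y i ℤ.* x j)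
  where open QuadraticForm Q

eval-+-* : ∀ {n} (Q : QuadraticForm n) x y s →
           eval Q (λ i → x i ℤ.+ s ℤ.* y i) ≡
           eval Q x ℤ.+ s ℤ.* polar Q x y ℤ.+ s ℤ.* s ℤ.* eval Q y
eval-+-* Q x y s = begin
  eval Q (λ i → x i ℤ.+ s ℤ.* y i)
    ≡⟨ sum²-cong (λ i j → expand (coeff i j) (x i) (x j) (y i) (y j) s) ⟩
  sum² (λ i j → f i j ℤ.+ sg i j ℤ.+ s²h i j)
    ≡⟨ sum²-distrib-+ (λ i j → f i j ℤ.+ sg i j) s²h ⟩
  sum² (λ i j → f i j ℤ.+ sg i j) ℤ.+ sum² s²h
    ≡⟨ cong (ℤ._+ sum² s²h) (sum²-distrib-+ f sg) ⟩
  sum² f ℤ.+ sum² sg ℤ.+ sum² s²h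
    ≡⟨ cong₂ (λ u v → sum² f ℤ.+ u ℤ.+ v) (*-distribˡ-sum² s g) (*-distribˡ-sum² (s ℤ.* s) h) ⟨
  eval Q x ℤ.+ s ℤ.* polar Q x y ℤ.+ s ℤ.* s ℤ.* eval Q y ∎
  where
  open ≡-Reasoning
  open QuadraticForm Q using (coeff)
  f g h sg s²h : Fin _ → Fin _ → ℤ
  f i j = coeff i j ℤ.* (x i ℤ.* x j)
  g i j = coeff i j ℤ.* (x i ℤ.* y j ℤ.+ y i ℤ.* x j)
  h i j = coeff i j ℤ.* (y i ℤ.* y j)
  sg i j = s ℤ.* g i j
  s²h i j = s ℤ.* s ℤ.* h i j
  expand : ∀ c a a′ b b′ s → c ℤ.* ((a ℤ.+ s ℤ.* b) ℤ.* (a′ ℤ.+ s ℤ.* b′)) ≡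
           c ℤ.* (a ℤ.* a′) ℤ.+ s ℤ.* (c ℤ.* (a ℤ.* b′ ℤ.+ b ℤ.* a′)) ℤ.+ s ℤ.* s ℤ.* (c ℤ.* (b ℤ.* b′))
  expand = solve-∀

-- Positive values in every translate.

∣i∣<n⇒0<i+n : ∀ i {n} → ∣ i ∣ ℕ.< n → 0ℤ ℤ.< i ℤ.+ + n
∣i∣<n⇒0<i+n (+ m)    {n} m<n = ℤ.+<+ (ℕ.<-≤-trans (ℕ.≤-<-trans ℕ.z≤n m<n) (ℕ.m≤n+m n m))
∣i∣<n⇒0<i+n -[1+ m ] {n} m<n =
  subst (0ℤ ℤ.<_) (sym (ℤ.⊖-≥ (ℕ.<⇒≤ m<n))) (ℤ.+<+ (ℕ.m<n⇒0<n∸m m<n))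

-- The square term dominates: `∣ a + s b ∣ ≤ s (∣ a ∣ + ∣ b ∣) < s² ≤ s² c`.
quadratic-positive : ∀ a b c .{{_ : Positive c}} s → ∣ a ∣ ℕ.+ ∣ b ∣ ℕ.< s →
                     Positive (a ℤ.+ + s ℤ.* b ℤ.+ + s ℤ.* + s ℤ.* c)
quadratic-positive a b c@(+[1+ k ]) s@(suc s-1) a+b<s =
  ℤ.positive (subst (λ i → 0ℤ ℤ.< a ℤ.+ + s ℤ.* b ℤ.+ i) (ℤ.pos-* (s ℕ.* s) (suc k))
    (∣i∣<n⇒0<i+n (a ℤ.+ + s ℤ.* b) (begin-strict
      ∣ a ℤ.+ + s ℤ.* b ∣             ≤⟨ ℤ.∣i+j∣≤∣i∣+∣j∣ a (+ s ℤ.* b) ⟩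
      ∣ a ∣ ℕ.+ ∣ + s ℤ.* b ∣         ≡⟨ cong (∣ a ∣ ℕ.+_) (ℤ.abs-* (+ s) b) ⟩
      ∣ a ∣ ℕ.+ s ℕ.* ∣ b ∣           ≤⟨ ℕ.+-monoˡ-≤ _ (ℕ.m≤n*m ∣ a ∣ s) ⟩
      s ℕ.* ∣ a ∣ ℕ.+ s ℕ.* ∣ b ∣     ≡⟨ ℕ.*-distribˡ-+ s ∣ a ∣ ∣ b ∣ ⟨
      s ℕ.* (∣ a ∣ ℕ.+ ∣ b ∣)         <⟨ ℕ.*-monoʳ-< s a+b<s ⟩
      s ℕ.* s                         ≤⟨ ℕ.m≤m*n (s ℕ.* s) (suc k) ⟩
      s ℕ.* s ℕ.* suc k               ∎)))
  where open ℕ.≤-Reasoning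

-- The multiplier of `y` is a natural number, so closure under natural multiples suffices; this
-- admits the orthant `ℕ^ n` besides the whole lattice. The vectors are then forgotten: only values
-- and their congruences matter for ratios.
positive-value : ∀ {n} (Q : QuadraticForm n) (S : Pred (Vector ℤ n) 0ℓ) →
                 (∀ {x y} s → x ∈ S → y ∈ S → (λ i → x i ℤ.+ + s ℤ.* y i) ∈ S) →
                 Satisfiable (Positive ∩ Q [ S ]) →
                 ∀ m .{{_ : NonZero m}} {a} → a ∈ Q [ S ] →
                 ∃ λ u → a ℤ.+ + m ℤ.* u ∈ Positive ∩ Q [ S ]
positive-value Q S closed (_ , Qy>0 , y , y∈S , refl) m (x , x∈S , refl) =
  + t ℤ.* b ℤ.+ + t ℤ.* + s ℤ.* c ,
  subst Positive (sym value) (quadratic-positive a b c {{Qy>0}} s (ℕ.m≤n*m t m)) ,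
  (λ i → x i ℤ.+ + s ℤ.* y i) , closed s x∈S y∈S , trans value (sym (eval-+-* Q x y (+ s)))
  where
  a = eval Q x
  b = polar Q x y
  c = eval Q y
  -- `t` exceeds the bound of `quadratic-positive`. The factor `m` in `s` keeps it above that bound
  -- and makes the change of value a multiple of `m`.
  t = suc (∣ a ∣ ℕ.+ ∣ b ∣)
  s = m ℕ.* t
  factor : ∀ a b c m t s → s ≡ m ℤ.* t →
           a ℤ.+ m ℤ.* (t ℤ.* b ℤ.+ t ℤ.* s ℤ.* c) ≡ a ℤ.+ s ℤ.* b ℤ.+ s ℤ.* s ℤ.* c
  factor a b c m t .(m ℤ.* t) refl = lemma a b c m t
    where
    lemma : ∀ a b c m t → a ℤ.+ m ℤ.* (t ℤ.* b ℤ.+ t ℤ.* (m ℤ.* t) ℤ.* c) ≡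
                          a ℤ.+ (m ℤ.* t) ℤ.* b ℤ.+ (m ℤ.* t) ℤ.* (m ℤ.* t) ℤ.* c
    lemma = solve-∀
  value : a ℤ.+ + m ℤ.* (+ t ℤ.* b ℤ.+ + t ℤ.* + s ℤ.* c) ≡
          a ℤ.+ + s ℤ.* b ℤ.+ + s ℤ.* + s ℤ.* c
  value = factor a b c (+ m) (+ t) (+ s) (ℤ.pos-* m t)

-- Ratios of integers, described by products.

+∣i∣*∣i∣≡i*i : ∀ i → + (∣ i ∣ ℕ.* ∣ i ∣) ≡ i ℤ.* i
+∣i∣*∣i∣≡i*i (+ n)    = ℤ.pos-* n n
+∣i∣*∣i∣≡i*i -[1+ n ] = refl

/1-nonZero⁻¹ : ∀ i → ℚ.NonZero (i ℚ./ 1) → ℤ.NonZero i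
/1-nonZero⁻¹ +[1+ n ] _ = _
/1-nonZero⁻¹ -[1+ n ] _ = _

/1-nonZero : ∀ i → Positive i → ℚ.NonZero (i ℚ./ 1)
/1-nonZero +[1+ n ] _ = ℚ.pos⇒nonZero (+[1+ n ] ℚ./ 1) {{ℚ.normalize-pos (suc n) 1}}

÷-*-cancel : ∀ q r .{{_ : ℚ.NonZero r}} → (q ÷ r) ℚ.* r ≡ q
÷-*-cancel q r = begin
  q ℚ.* 1/ r ℚ.* r     ≡⟨ ℚ.*-assoc q (1/ r) r ⟩
  q ℚ.* (1/ r ℚ.* r)   ≡⟨ cong (q ℚ.*_) (ℚ.*-inverseˡ r) ⟩
  q ℚ.* ℚ.1ℚ           ≡⟨ ℚ.*-identityʳ q ⟩
  q                    ∎
  where open ≡-Reasoning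

-- As the second denominator is a multiple `b d` of the first, `b d` already serves as common
-- denominator, without a further factor `b`.
ratio-difference : ∀ q q′ a a′ b d → q ℚ.* (b ℚ./ 1) ≡ a ℚ./ 1 →
                   q′ ℚ.* ((b ℤ.* d) ℚ./ 1) ≡ a′ ℚ./ 1 →
                   (q ℚ.- q′) ℚ.* ((b ℤ.* d) ℚ./ 1) ≡ (a ℤ.* d ℤ.- a′) ℚ./ 1
ratio-difference q q′ a a′ b d qb≡a q′bd≡a′ = begin
  (q ℚ.- q′) ℚ.* ((b ℤ.* d) ℚ./ 1)
    ≡⟨ ℚ.*-distribʳ-+ ((b ℤ.* d) ℚ./ 1) q (ℚ.- q′) ⟩
  q ℚ.* ((b ℤ.* d) ℚ./ 1) ℚ.+ ℚ.- q′ ℚ.* ((b ℤ.* d) ℚ./ 1)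
    ≡⟨ cong₂ ℚ._+_ qbd≡ad (sym (ℚ.neg-distribˡ-* q′ _)) ⟩
  ((a ℤ.* d) ℚ./ 1) ℚ.- q′ ℚ.* ((b ℤ.* d) ℚ./ 1)
    ≡⟨ cong (λ r → ((a ℤ.* d) ℚ./ 1) ℚ.- r) q′bd≡a′ ⟩
  ((a ℤ.* d) ℚ./ 1) ℚ.- (a′ ℚ./ 1)
    ≡⟨ cong (λ i → (i ℚ./ 1) ℚ.- (a′ ℚ./ 1)) (difference (a ℤ.* d) a′) ⟩
  (((a ℤ.* d ℤ.- a′) ℤ.+ a′) ℚ./ 1) ℚ.- (a′ ℚ./ 1)
    ≡⟨ cong (ℚ._- (a′ ℚ./ 1)) (/1-homo-+ (a ℤ.* d ℤ.- a′) a′) ⟩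
  ((a ℤ.* d ℤ.- a′) ℚ./ 1) ℚ.+ (a′ ℚ./ 1) ℚ.- (a′ ℚ./ 1)
    ≡⟨ solve 2 (λ r t → r :+ t :- t := r) refl ((a ℤ.* d ℤ.- a′) ℚ./ 1) (a′ ℚ./ 1) ⟩
  (a ℤ.* d ℤ.- a′) ℚ./ 1 ∎
  where
  open ≡-Reasoning
  open ℚ.+-*-Solver
  difference : ∀ i j → i ≡ i ℤ.- j ℤ.+ j
  difference = solve-∀
  qbd≡ad : q ℚ.* ((b ℤ.* d) ℚ./ 1) ≡ (a ℤ.* d) ℚ./ 1
  qbd≡ad = begin
    q ℚ.* ((b ℤ.* d) ℚ./ 1)              ≡⟨ cong (q ℚ.*_) (/1-homo-* b d) ⟩
    q ℚ.* ((b ℚ./ 1) ℚ.* (d ℚ./ 1))      ≡⟨ ℚ.*-assoc q (b ℚ./ 1) (d ℚ./ 1) ⟨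
    q ℚ.* (b ℚ./ 1) ℚ.* (d ℚ./ 1)        ≡⟨ cong (ℚ._* (d ℚ./ 1)) qb≡a ⟩
    (a ℚ./ 1) ℚ.* (d ℚ./ 1)              ≡⟨ /1-homo-* a d ⟨
    (a ℤ.* d) ℚ./ 1                      ∎

-- Monotonicity, and a positive value obtained from a ratio.

Ratios-mono : ∀ {A B} → A ⊆ B → R A ⊆ R B
Ratios-mono A⊆B (r , t , (a , a∈A , r≡a) , (b , b∈A , t≡b) , t≢0 , q≡) =
  r , t , (a , A⊆B a∈A , r≡a) , (b , A⊆B b∈A , t≡b) , t≢0 , q≡

DenseInℚₚ-mono : ∀ {p A B} → A ⊆ B → DenseInℚₚ p A → DenseInℚₚ p B
DenseInℚₚ-mono A⊆B dense x k with dense x k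
... | q , q∈A , near = q , A⊆B q∈A , near

-- The denominator of the ratio is the witness, being nonnegative and nonzero.
R-NonNegative⇒Positive : ∀ {V q} → q ∈ R (NonNegative ∩ V) → Satisfiable (Positive ∩ V)
R-NonNegative⇒Positive (_ , _ , _ , (b , (b≥0 , b∈V) , refl) , b≢0 , _) =
  b , nonNeg∧nonZero⇒pos b b≥0 (/1-nonZero⁻¹ b b≢0) , b∈V
  where
  nonNeg∧nonZero⇒pos : ∀ i → NonNegative i → ℤ.NonZero i → Positive i
  nonNeg∧nonZero⇒pos +[1+ n ] _ _ = _

-- Estimates of the p-adic norm through numerators.

module _ {p : ℕ} (p-prime : Prime p) where

  private instance
    p-nonZero    = prime⇒nonZero p-prime
    p-nonTrivial = prime⇒nonTrivial p-prime

  p∤1 : p ∤ 1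
  p∤1 p∣1 = ℕ.nonTrivial⇒≢1 (ℕ.∣1⇒≡1 p∣1)

  -- By induction on `e`: Euclid's lemma puts a factor `p` into `m`, and it is cancelled from both
  -- sides.
  p∤d∧p^e∣m*d⇒p^e∣m : ∀ {d} → p ∤ d → ∀ e m → p ℕ.^ e ∣ m ℕ.* d → p ℕ.^ e ∣ m
  p∤d∧p^e∣m*d⇒p^e∣m p∤d zero m _ = ℕ.1∣ m
  p∤d∧p^e∣m*d⇒p^e∣m {d} p∤d (suc e) m pᵉ∣md
    with euclidsLemma m d p-prime (ℕ.∣-trans (p∣p^suc p e) pᵉ∣md)
  ... | inj₂ p∣d            = contradiction p∣d p∤d
  ... | inj₁ (divides c refl) = subst (p ℕ.^ suc e ∣_) (ℕ.*-comm p c)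
    (ℕ.*-monoʳ-∣ p (p∤d∧p^e∣m*d⇒p^e∣m p∤d e c (ℕ.*-cancelˡ-∣ p
      (subst (p ℕ.^ suc e ∣_) (trans (cong (ℕ._* d) (ℕ.*-comm c p)) (ℕ.*-assoc p c d)) pᵉ∣md))))

  p∣↥⇒p∤↧ : ∀ q → p ∣ ∣ ↥ q ∣ → p ∤ ↧ₙ q
  p∣↥⇒p∤↧ (mkℚ _ _ coprime) p∣↥ p∣↧ =
    ℕ.nonTrivial⇒≢1 (C.recompute coprime (p∣↥ , p∣↧))

  -- Approximations of radius p ^ (- k) with k ≥ 1 suffice for density, and for
  -- such k the bound Norm≤ p k only concerns the numerator.
  Norm≤⇒∣↥ : ∀ e q → Norm≤ p (+ e) q → p ℕ.^ e ∣ ∣ ↥ q ∣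
  Norm≤⇒∣↥ e q ∣q∣≤ with q ℚ.≟ 0ℚ
  -- The norm bound is vacuous at zero, but every power divides the numerator 0.
  ... | yes refl = (p ℕ.^ e) ℕ.∣0
  ... | no  q≢0  = ℕ.∣-trans (p^-mono e≤ν) (maxExponent-∣ p ∣ ↥ q ∣ ∣ ↥ q ∣)
    where
    e≤ν : e ℕ.≤ νℕ p ∣ ↥ q ∣
    -- Subtracting the valuation of the denominator can only lower `ν`.
    e≤ν = ℤ.drop‿+≤+ (ℤ.≤-trans (∣q∣≤ q≢0) (ℤ.i≤j⇒i-k≤j (+ νℕ p (↧ₙ q)) ℤ.≤-refl))
    p^-mono : ∀ {m n} → m ℕ.≤ n → p ℕ.^ m ∣ p ℕ.^ n
    p^-mono {m} {n} m≤n = subst (λ k → p ℕ.^ m ∣ p ℕ.^ k) (ℕ.m+[n∸m]≡n m≤n)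
      (subst (p ℕ.^ m ∣_) (sym (ℕ.^-distribˡ-+-* p m (n ℕ.∸ m))) (ℕ.m∣m*n _))

  -- A positive exponent puts `p` into the numerator, so the coprime denominator has valuation 0.
  -- With exponent 0 this fails, as for `1 / p`.
  ∣↥⇒Norm≤ : ∀ e q → p ℕ.^ suc e ∣ ∣ ↥ q ∣ → Norm≤ p (+ suc e) q
  ∣↥⇒Norm≤ e q pᵉ∣↥ q≢0
    rewrite p∤m⇒νℕ≡0 (p∣↥⇒p∤↧ q (ℕ.∣-trans (p∣p^suc p e) pᵉ∣↥))
          | ℤ.+-identityʳ (+ νℕ p ∣ ↥ q ∣)
    = ℤ.+≤+ (νℕ-max p ∣ ↥ q ∣ {{≢0⇒↥-nonZero q≢0}} pᵉ∣↥)

  -- The ultrametric inequality for positive exponents: the power divides both cross terms, and the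
  -- denominators, prime to `p`, cancel.
  Norm≤-+ : ∀ e q r → Norm≤ p (+ suc e) q → Norm≤ p (+ suc e) r → Norm≤ p (+ suc e) (q ℚ.+ r)
  Norm≤-+ e q r ∣q∣≤ ∣r∣≤ = ∣↥⇒Norm≤ e (q ℚ.+ r)
    (p∤d∧p^e∣m*d⇒p^e∣m p∤↧q↧r (suc e) ∣ ↥ (q ℚ.+ r) ∣
      (subst (P ∣_) (ℤ.abs-* (↥ (q ℚ.+ r)) (↧ q ℤ.* ↧ r)) (ℤ∣.∣⇒∣ᵤ
        (subst (+ P ℤ∣.∣_) (sym (↥-+-cross q r))
          (ℤ∣.∣m⇒∣m*n (↧ (q ℚ.+ r)) (ℤ∣.∣m∣n⇒∣m+n
            (ℤ∣.∣m⇒∣m*n (↧ r) (ℤ∣.∣ᵤ⇒∣ {i = ↥ q} P∣↥q))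
            (ℤ∣.∣m⇒∣m*n (↧ q) (ℤ∣.∣ᵤ⇒∣ {i = ↥ r} P∣↥r))))))))
    where
    P = p ℕ.^ suc e
    P∣↥q = Norm≤⇒∣↥ (suc e) q ∣q∣≤
    P∣↥r = Norm≤⇒∣↥ (suc e) r ∣r∣≤
    p∤↧q↧r : p ∤ ∣ ↧ q ℤ.* ↧ r ∣
    p∤↧q↧r p∣ with euclidsLemma (↧ₙ q) (↧ₙ r) p-prime p∣
    ... | inj₁ p∣↧q = p∣↥⇒p∤↧ q (ℕ.∣-trans (p∣p^suc p e) P∣↥q) p∣↧q
    ... | inj₂ p∣↧r = p∣↥⇒p∤↧ r (ℕ.∣-trans (p∣p^suc p e) P∣↥r) p∣↧r

  -- Serves for a fraction `P c / d` not in lowest terms: `i` then absorbs the factor `↧ q`.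
  Norm≤-fraction : ∀ e q i d → p ∤ ∣ d ∣ → ↥ q ℤ.* d ≡ + (p ℕ.^ suc e) ℤ.* i → Norm≤ p (+ suc e) q
  Norm≤-fraction e q i d p∤d eq = ∣↥⇒Norm≤ e q
    (p∤d∧p^e∣m*d⇒p^e∣m p∤d (suc e) ∣ ↥ q ∣ (subst (P ∣_) (ℤ.abs-* (↥ q) d)
      (ℤ∣.∣⇒∣ᵤ (ℤ∣.divides i (trans eq (ℤ.*-comm (+ P) i))))))
    where P = p ℕ.^ suc e

  -- One factor `b` of the modulus makes `b` divide the new denominator; the second cancels the `b`
  -- that would otherwise remain below in the difference.
  Norm≤-ratio : ∀ e q q′ a b u v .{{_ : ℤ.NonZero b}} →
    q ℚ.* (b ℚ./ 1) ≡ a ℚ./ 1 →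
    q′ ℚ.* ((b ℤ.+ + (p ℕ.^ suc e) ℤ.* (b ℤ.* b) ℤ.* v) ℚ./ 1) ≡
      (a ℤ.+ + (p ℕ.^ suc e) ℤ.* (b ℤ.* b) ℤ.* u) ℚ./ 1 →
    Norm≤ p (+ suc e) (q ℚ.- q′)
  Norm≤-ratio e q q′ a b u v qb≡a q′b′≡a′ = Norm≤-fraction e r (c ℤ.* ↧ r) d p∤d
    -- Here `a d - a′ = P b (a v - b u)`, so both sides carry the factor `b`.
    (ℤ.*-cancelʳ-≡ _ _ b (begin
      ↥ r ℤ.* d ℤ.* b             ≡⟨ reorder (↥ r) d b ⟩
      ↥ r ℤ.* (b ℤ.* d)           ≡⟨ q*i≡j⇒↥q*i≡j*↧q r (b ℤ.* d) (a ℤ.* d ℤ.- a′) rbd≡ad-a′ ⟩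
      (a ℤ.* d ℤ.- a′) ℤ.* ↧ r    ≡⟨ collect a b u v P (↧ r) ⟩
      P ℤ.* (c ℤ.* ↧ r) ℤ.* b     ∎))
    where
    open ≡-Reasoning
    P = + (p ℕ.^ suc e)
    r = q ℚ.- q′
    d = 1ℤ ℤ.+ P ℤ.* (b ℤ.* v)
    c = a ℤ.* v ℤ.- b ℤ.* u
    a′ = a ℤ.+ P ℤ.* (b ℤ.* b) ℤ.* u
    factor : ∀ b P v → b ℤ.+ P ℤ.* (b ℤ.* b) ℤ.* v ≡ b ℤ.* (1ℤ ℤ.+ P ℤ.* (b ℤ.* v))
    factor = solve-∀
    reorder : ∀ i j k → i ℤ.* j ℤ.* k ≡ i ℤ.* (k ℤ.* j)
    reorder = solve-∀
    collect : ∀ a b u v P D →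
      (a ℤ.* (1ℤ ℤ.+ P ℤ.* (b ℤ.* v)) ℤ.- (a ℤ.+ P ℤ.* (b ℤ.* b) ℤ.* u)) ℤ.* D ≡
      P ℤ.* ((a ℤ.* v ℤ.- b ℤ.* u) ℤ.* D) ℤ.* b
    collect = solve-∀
    rbd≡ad-a′ : r ℚ.* ((b ℤ.* d) ℚ./ 1) ≡ (a ℤ.* d ℤ.- a′) ℚ./ 1
    rbd≡ad-a′ = ratio-difference q q′ a a′ b d qb≡a
      (trans (cong (λ i → q′ ℚ.* (i ℚ./ 1)) (sym (factor b P v))) q′b′≡a′)
    p∤d : p ∤ ∣ d ∣
    -- `d` is 1 modulo `p`, because `P` has a positive exponent.
    p∤d p∣d = p∤1 (ℤ∣.∣⇒∣ᵤ (ℤ∣.∣m+n∣n⇒∣m {+ p} {1ℤ} {P ℤ.* (b ℤ.* v)} (ℤ∣.∣ᵤ⇒∣ p∣d)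
      (ℤ∣.∣m⇒∣m*n (b ℤ.* v) (ℤ∣.∣ᵤ⇒∣ {+ p} {P} (p∣p^suc p e)))))

  -- Transfer of density, for any set of integers with positive elements in all translates.

  module _ {V : Pred ℤ 0ℓ}
    (positive-translate : ∀ m .{{_ : NonZero m}} {a} → a ∈ V →
                          ∃ λ u → a ℤ.+ + m ℤ.* u ∈ Positive ∩ V)
    where

    R-approximation : ∀ e {q} → q ∈ R V →
                      ∃ λ q′ → q′ ∈ R (NonNegative ∩ V) × Norm≤ p (+ suc e) (q ℚ.- q′)
    R-approximation e {q} (_ , _ , (a , a∈V , refl) , (b , b∈V , refl) , b≢0 , refl)
      = q′ , (_ , _ , (a′ , (pos⇒nonNeg a′ a′>0 , a′∈V) , refl)
                    , (b′ , (pos⇒nonNeg b′ b′>0 , b′∈V) , refl) , b′≢0 , refl) ,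
        Norm≤-ratio e q q′ a b u v {{b-nonZero}}
          (÷-*-cancel (a ℚ./ 1) (b ℚ./ 1) {{b≢0}})
          (subst (λ M → q′ ℚ.* ((b ℤ.+ M ℤ.* v) ℚ./ 1) ≡ (a ℤ.+ M ℤ.* u) ℚ./ 1) +m≡Pbb
            (÷-*-cancel (a′ ℚ./ 1) (b′ ℚ./ 1) {{b′≢0}}))
      where
      P = p ℕ.^ suc e
      -- The same modulus serves numerator and denominator; it is nonzero because `b` is.
      m = P ℕ.* (∣ b ∣ ℕ.* ∣ b ∣)
      b-nonZero = /1-nonZero⁻¹ b b≢0
      m-nonZero : NonZero m
      m-nonZero = ℕ.m*n≢0 P (∣ b ∣ ℕ.* ∣ b ∣) {{ℕ.m^n≢0 p (suc e)}}
                    {{ℕ.m*n≢0 ∣ b ∣ ∣ b ∣ {{b-nonZero}} {{b-nonZero}}}}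
      +m≡Pbb : + m ≡ + P ℤ.* (b ℤ.* b)
      +m≡Pbb = trans (ℤ.pos-* P _) (cong (+ P ℤ.*_) (+∣i∣*∣i∣≡i*i b))
      translate-a = positive-translate m {{m-nonZero}} a∈V
      translate-b = positive-translate m {{m-nonZero}} b∈V
      u = proj₁ translate-a
      v = proj₁ translate-b
      a′ = a ℤ.+ + m ℤ.* u
      b′ = b ℤ.+ + m ℤ.* v
      a′>0 = proj₁ (proj₂ translate-a)
      b′>0 = proj₁ (proj₂ translate-b)
      a′∈V = proj₂ (proj₂ translate-a)
      b′∈V = proj₂ (proj₂ translate-b)
      b′≢0 = /1-nonZero b′ b′>0
      q′ = ((a′ ℚ./ 1) ÷ (b′ ℚ./ 1)) {{b′≢0}}
      pos⇒nonNeg : ∀ i → Positive i → NonNegative i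
      pos⇒nonNeg +[1+ n ] _ = _

    dense-R⇒dense-R-NonNegative : DenseInℚₚ p (R V) → DenseInℚₚ p (R (NonNegative ∩ V))
    dense-R⇒dense-R-NonNegative dense x k
      -- The exponent `suc ∣ k ∣` is at least `k`, and positive as the ultrametric step requires.
      with dense x (+ suc ∣ k ∣)
    ... | q , q∈R , N , near with R-approximation ∣ k ∣ q∈R
    ...   | q′ , q′∈R , q-q′≤ = q′ , q′∈R , N , λ m N≤m x-q′≢0 →
      ℤ.≤-trans (ℤ.≤-trans (i≤+∣i∣ k) (ℤ.+≤+ (ℕ.n≤1+n ∣ k ∣)))
        (subst (Norm≤ p (+ suc ∣ k ∣)) (telescope (seq x m) q q′)
          (Norm≤-+ ∣ k ∣ (seq x m ℚ.- q) (q ℚ.- q′) (near m N≤m) q-q′≤) x-q′≢0)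
      where
      open ℚ.+-*-Solver
      telescope : ∀ r q q′ → r ℚ.- q ℚ.+ (q ℚ.- q′) ≡ r ℚ.- q′
      telescope = solve 3 (λ r q q′ → r :- q :+ (q :- q′) := r :- q′) refl

  -- The equivalence for the lattice and for the orthant.

  dense⇔ : ∀ {n} (Q : QuadraticForm n) (S : Pred (Vector ℤ n) 0ℓ) →
           (∀ {x y} s → x ∈ S → y ∈ S → (λ i → x i ℤ.+ + s ℤ.* y i) ∈ S) →
           DenseInℚₚ p (R (NonNegative ∩ Q [ S ])) ⇔
           (DenseInℚₚ p (R (Q [ S ])) × Satisfiable (Positive ∩ Q [ S ]))
  dense⇔ Q S closed = mk⇔
    (λ dense → DenseInℚₚ-mono (Ratios-mono proj₂) dense ,
               -- Density is applied to one arbitrary ball, only to obtain some ratio.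
               R-NonNegative⇒Positive (proj₁ (proj₂ (dense (ι p 0ℚ) 0ℤ))))
    (λ (dense , positive) → dense-R⇒dense-R-NonNegative (positive-value Q S closed positive) dense)

theorem2 : ∀ (p : ℕ) → Prime p → ∀ (n : ℕ) → .{{_ : NonZero n}} → (Q : QuadraticForm n) →
    (DenseInℚₚ p (R (NonNegative ∩ Q [ U ])) ⇔
    (DenseInℚₚ p (R (Q [ U ])) × Satisfiable (Positive ∩ Q [ U ])))
    ×
    (DenseInℚₚ p (R (NonNegative ∩ Q [ ℕ^ n ])) ⇔
    (DenseInℚₚ p (R (Q [ ℕ^ n ])) × Satisfiable (Positive ∩ Q [ ℕ^ n ])))
theorem2 p p-prime n Q =
  dense⇔ p-prime Q U _ ,
  dense⇔ p-prime Q (ℕ^ n) λ {x} {y} s x≥0 y≥0 i →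
    ℤ.nonNegative (ℤ.+-mono-≤ (ℤ.nonNegative⁻¹ (x i) {{x≥0 i}})
      (subst (ℤ._≤ + s ℤ.* y i) (ℤ.*-zeroʳ (+ s))
        (ℤ.*-monoˡ-≤-nonNeg (+ s) (ℤ.nonNegative⁻¹ (y i) {{y≥0 i}}))))
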